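{- For all integers $n\geq0$, we have \[ \mathcal{EO}_u(2n)=\sum_{k=0}^{\left\lfloor\frac{\sqrt{1+8n}-1}{2}\right\rfloor }p\left(n-\frac{k(k+1)}{2}\right). \]
   Context: For a positive integer $k$, let $f_k:=(q^k;q^k)_\infty=\prod_{i=1}^\infty(1-q^{ki})$. The integers $\mathcal{EO}_u(n)$, $n\ge 0$, are defined by $\sum_{n=0}^\infty \mathcal{EO}_u(n)q^n=\dfrac{f_4^2}{f_2^2}$. Here $p(n)$ denotes the number of partitions of the nonnegative integer $n$, with $p(0)=1$, so that $\sum_{n=0}^\infty p(n)q^n=1/f_1$. -}

module Defs where

open import Data.Nat as ℕ using (ℕ; zero; suc; NonZero; z≤n; s≤s)
import Data.Nat.Properties as ℕ
open import Data.Nat.DivMod using (m/n*n≤m; m*n/n≡m; /-monoˡ-≤)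
open import Data.Integer using (ℤ; 0ℤ; 1ℤ; _+_; _*_; _-_)
import Data.Integer.Properties as ℤ
open import Data.Fin using (toℕ)
open import Data.Nat.ListAction using (sum)
open import Data.List using (List; []; _∷_; _++_; map; filter; length)
open import Data.List.Membership.Propositional using (_∈_)
open import Data.List.Membership.Propositional.Properties
  using (∈-++⁺ˡ; ∈-++⁺ʳ; ∈-++⁻; ∈-map⁺; ∈-map⁻; ∈-filter⁺; ∈-filter⁻)
open import Data.List.Relation.Binary.Disjoint.Propositional using (Disjoint)
open import Data.List.Relation.Unary.Any using (here)
open import Data.List.Relation.Unary.All using (All; []; _∷_)
import Data.List.Relation.Unary.All as All
open import Data.List.Relation.Unary.AllPairs using (AllPairs; []; _∷_)
open import Data.List.Relation.Unary.Unique.Propositional using (Unique)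
import Data.List.Relation.Unary.Unique.Propositional.Properties as Unique
open import Data.List.Properties using (∷-injectiveʳ)
open import Data.Product using (_×_; _,_; proj₁; proj₂)
open import Data.Sum using (inj₁; inj₂)
open import Function.Bundles using (_⇔_; mk⇔)
open import Relation.Nullary using (yes; no; contradiction)
open import Relation.Binary.PropositionalEquality
  using (_≡_; refl; sym; trans; cong; cong₂; module ≡-Reasoning)

module ℕ-Sum where
  open import Algebra.Properties.Semiring.Sum ℕ.+-*-semiring public

module ℤ-Sum where
  open import Algebra.Properties.Semiring.Sum ℤ.+-*-semiring public

-- Formal power series in q; a n is the coefficient of q^n.
Series : Set
Series = ℕ → ℤ

infixl 7 _·_

-- The summation index ranges over Fin (suc n), that is, 0 ≤ i ≤ n.
_·_ : Series → Series → Series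
(a · b) n = ∑[ i ≤ n ] (a (toℕ i) * b (n ℕ.∸ toℕ i))
  where open ℤ-Sum using (sum⁺-syntax)

q^ : ℕ → Series
q^ m n with n ℕ.≟ m
... | yes _ = 1ℤ
... | no _  = 0ℤ

1-q^ : ℕ → Series
1-q^ m n = q^ 0 n - q^ m n

-- The quotient a / b of power series when b has constant term 1, by long
-- division: a / b = a₀ + q ((a - a₀ b) / q) / b.
divide : (a b : Series) → b 0 ≡ 1ℤ → Series
divide a b b₀≡1 zero    = a 0
divide a b b₀≡1 (suc n) =
  divide (λ m → a (suc m) - a 0 * b (suc m)) b b₀≡1 n

divide-correct : ∀ a b (b₀≡1 : b 0 ≡ 1ℤ) n → (divide a b b₀≡1 · b) n ≡ a n
divide-correct a b b₀≡1 zero = begin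
  a 0 * b 0 + 0ℤ ≡⟨ ℤ.+-identityʳ _ ⟩
  a 0 * b 0      ≡⟨ cong (a 0 *_) b₀≡1 ⟩
  a 0 * 1ℤ       ≡⟨ ℤ.*-identityʳ _ ⟩
  a 0            ∎
  where open ≡-Reasoning
divide-correct a b b₀≡1 (suc n) = begin
  x + (divide a′ b b₀≡1 · b) n
    ≡⟨ cong (x +_) (divide-correct a′ b b₀≡1 n) ⟩
  x + (a (suc n) - x)
    ≡⟨ ℤ.+-assoc x (a (suc n)) _ ⟨
  x + a (suc n) - x
    ≡⟨ xyx⁻¹≈y x (a (suc n)) ⟩
  a (suc n)
    ∎
  where
  open ≡-Reasoning
  open import Algebra.Properties.AbelianGroup ℤ.+-0-abelianGroup using (xyx⁻¹≈y)
  x = a 0 * b (suc n)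
  a′ : Series
  a′ m = a (suc m) - a 0 * b (suc m)

-- ∏_{1 ≤ i ≤ N} (1 - q^{k i})
f-partial : ℕ → ℕ → Series
f-partial k zero    = q^ 0
f-partial k (suc N) = f-partial k N · 1-q^ (k ℕ.* suc N)

-- The infinite product (q^k; q^k)_∞.  Since k ≥ 1, the factors with i > n do
-- not affect the coefficient of q^n (see f-stable).
f : (k : ℕ) → .{{NonZero k}} → Series
f k n = f-partial k n n

EOᵤ : Series
EOᵤ = divide (f 4 · f 4) (f 2 · f 2) refl

IsPartition : ℕ → List ℕ → Set
IsPartition n xs = AllPairs ℕ._≥_ xs × All (1 ℕ.≤_) xs × sum xs ≡ n

-- All non-increasing lists of at most l parts, each part between 1 and m.
box : (m l : ℕ) → List (List ℕ)
box zero    l       = [] ∷ []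
box (suc m) zero    = [] ∷ []
box (suc m) (suc l) = box m (suc l) ++ map (suc m ∷_) (box (suc m) l)

-- A partition of n has at most n parts, each at most n, so this lists every
-- partition of n exactly once (see ∈-partitions and partitions-unique).
partitions : ℕ → List (List ℕ)
partitions n = filter (λ xs → sum xs ℕ.≟ n) (box n n)

p : ℕ → ℕ
p n = length (partitions n)

-- The largest r with r² ≤ n (see ⌊√⌋-correct).
⌊√_⌋ : ℕ → ℕ
⌊√ zero ⌋  = 0
⌊√ suc n ⌋ with ⌊√ n ⌋
... | r with suc r ℕ.* suc r ℕ.≤? suc n
...   | yes _ = suc r
...   | no _  = r

⌊√⌋-correct : ∀ n → (⌊√ n ⌋ ℕ.* ⌊√ n ⌋ ℕ.≤ n) × (n ℕ.< suc ⌊√ n ⌋ ℕ.* suc ⌊√ n ⌋)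
⌊√⌋-correct zero = z≤n , s≤s z≤n
⌊√⌋-correct (suc n) with ⌊√ n ⌋ | ⌊√⌋-correct n
... | r | r²≤n , n<[1+r]² with suc r ℕ.* suc r ℕ.≤? suc n
...   | yes [1+r]²≤ = [1+r]²≤ , ℕ.≤-<-trans n<[1+r]²
                        (ℕ.*-mono-< (ℕ.n<1+n (suc r)) (ℕ.n<1+n (suc r)))
...   | no [1+r]²≰  = ℕ.m≤n⇒m≤1+n r²≤n , ℕ.≰⇒> [1+r]²≰

-- For m ≥ 1 the floor of the real number (√m - 1) / 2 is
-- (⌊√ m ⌋ ∸ 1) / 2: the naturals k ≤ (√m - 1) / 2 are those with
-- (2k + 1)² ≤ m.  For m = 1 + 8n this says k(k+1)/2 ≤ n, so that subtracting
-- k(k+1)/2 from n does not truncate.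
≤-floor : ∀ m k → 1 ℕ.≤ m →
          k ℕ.≤ (⌊√ m ⌋ ℕ.∸ 1) ℕ./ 2 ⇔
          suc (k ℕ.* 2) ℕ.* suc (k ℕ.* 2) ℕ.≤ m
≤-floor m k 1≤m = mk⇔ to from
  where
  r² = proj₁ (⌊√⌋-correct m)
  <[1+r]² = proj₂ (⌊√⌋-correct m)
  ≤⌊√⌋ : ∀ j → j ℕ.* j ℕ.≤ m → j ℕ.≤ ⌊√ m ⌋
  ≤⌊√⌋ j j²≤m = ℕ.≮⇒≥ λ r<j →
    ℕ.<-irrefl refl (ℕ.<-≤-trans <[1+r]² (ℕ.≤-trans (ℕ.*-mono-≤ r<j r<j) j²≤m))
  to : _ → _
  to k≤ = ℕ.≤-trans (ℕ.*-mono-≤ 2k<r 2k<r) r²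
    where
    2k<r : suc (k ℕ.* 2) ℕ.≤ ⌊√ m ⌋
    2k<r = ℕ.≤-trans
      (s≤s (ℕ.≤-trans (ℕ.*-monoˡ-≤ 2 k≤) (m/n*n≤m (⌊√ m ⌋ ℕ.∸ 1) 2)))
      (ℕ.≤-reflexive (ℕ.m+[n∸m]≡n (≤⌊√⌋ 1 1≤m)))
  from : _ → _
  from [2k+1]²≤m = ℕ.≤-trans
    (ℕ.≤-reflexive (sym (m*n/n≡m k 2)))
    (/-monoˡ-≤ 2 (ℕ.∸-monoˡ-≤ 1 (≤⌊√⌋ (suc (k ℕ.* 2)) [2k+1]²≤m)))

1-q^-small : ∀ m j .{{_ : NonZero j}} → j ℕ.< m → 1-q^ m j ≡ 0ℤ
1-q^-small m (suc j) j<m with suc j ℕ.≟ m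
... | yes refl = contradiction j<m (ℕ.<-irrefl refl)
... | no _     = refl

1-q^-zero : ∀ m → 0 ℕ.< m → 1-q^ m 0 ≡ 1ℤ
1-q^-zero (suc m) _ = refl

·-1-q^-low : ∀ a m n → n ℕ.< m → (a · 1-q^ m) n ≡ a n
·-1-q^-low a m zero 0<m = begin
  a 0 * 1-q^ m 0 + 0ℤ ≡⟨ ℤ.+-identityʳ _ ⟩
  a 0 * 1-q^ m 0      ≡⟨ cong (a 0 *_) (1-q^-zero m 0<m) ⟩
  a 0 * 1ℤ            ≡⟨ ℤ.*-identityʳ _ ⟩
  a 0                 ∎
  where open ≡-Reasoning
·-1-q^-low a m (suc n) n<m = begin
  a 0 * 1-q^ m (suc n) + ((λ i → a (suc i)) · 1-q^ m) n
    ≡⟨ cong₂ _+_ (cong (a 0 *_) (1-q^-small m (suc n) n<m))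
                 (·-1-q^-low (λ i → a (suc i)) m n (ℕ.<-trans (ℕ.n<1+n n) n<m)) ⟩
  a 0 * 0ℤ + a (suc n)
    ≡⟨ cong (_+ a (suc n)) (ℤ.*-zeroʳ (a 0)) ⟩
  0ℤ + a (suc n)
    ≡⟨ ℤ.+-identityˡ _ ⟩
  a (suc n)
    ∎
  where open ≡-Reasoning

f-stable : ∀ k .{{_ : NonZero k}} n d → f-partial k (d ℕ.+ n) n ≡ f k n
f-stable k n zero    = refl
f-stable k n (suc d) = trans
  (·-1-q^-low (f-partial k (d ℕ.+ n)) (k ℕ.* suc (d ℕ.+ n)) n
    (ℕ.<-≤-trans (s≤s (ℕ.m≤n+m n d)) (ℕ.m≤n*m (suc (d ℕ.+ n)) k)))
  (f-stable k n d)

InBox : ℕ → ℕ → List ℕ → Set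
InBox m l xs =
  AllPairs ℕ._≥_ xs × All (1 ℕ.≤_) xs × All (ℕ._≤ m) xs × length xs ℕ.≤ l

box-sound : ∀ m l {xs} → xs ∈ box m l → InBox m l xs
box-sound zero    l    (here refl) = [] , [] , [] , z≤n
box-sound (suc m) zero (here refl) = [] , [] , [] , z≤n
box-sound (suc m) (suc l) xs∈ with ∈-++⁻ (box m (suc l)) xs∈
... | inj₁ xs∈ˡ with box-sound m (suc l) xs∈ˡ
...   | desc , pos , bnd , len = desc , pos , All.map ℕ.m≤n⇒m≤1+n bnd , len
box-sound (suc m) (suc l) xs∈ | inj₂ xs∈ʳ with ∈-map⁻ (suc m ∷_) xs∈ʳ
...   | ys , ys∈ , refl with box-sound (suc m) l ys∈
...     | desc , pos , bnd , len =
  bnd ∷ desc , s≤s z≤n ∷ pos , ℕ.≤-refl ∷ bnd , s≤s len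

[]∈box : ∀ m l → [] ∈ box m l
[]∈box zero    l       = here refl
[]∈box (suc m) zero    = here refl
[]∈box (suc m) (suc l) = ∈-++⁺ˡ ([]∈box m (suc l))

box-complete : ∀ m l xs → InBox m l xs → xs ∈ box m l
box-complete m l [] _ = []∈box m l
box-complete zero l (x ∷ xs) (_ , 1≤x ∷ _ , x≤0 ∷ _ , _) =
  contradiction (ℕ.≤-trans 1≤x x≤0) λ ()
box-complete (suc m) (suc l) (x ∷ xs) (x≥ ∷ desc , 1≤x ∷ pos , x≤ ∷ bnd , s≤s len)
  with x ℕ.≟ suc m
... | yes refl = ∈-++⁺ʳ (box m (suc l))
  (∈-map⁺ (suc m ∷_) (box-complete (suc m) l xs (desc , pos , bnd , len)))
... | no x≢ = ∈-++⁺ˡ (box-complete m (suc l) (x ∷ xs)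
  (x≥ ∷ desc , 1≤x ∷ pos , x≤m ∷ All.map (λ y≤x → ℕ.≤-trans y≤x x≤m) x≥ , s≤s len))
  where
  x≤m : x ℕ.≤ m
  x≤m = ℕ.s≤s⁻¹ (ℕ.≤∧≢⇒< x≤ x≢)

box-unique : ∀ m l → Unique (box m l)
box-unique zero    l       = [] ∷ []
box-unique (suc m) zero    = [] ∷ []
box-unique (suc m) (suc l) = Unique.++⁺ (box-unique m (suc l))
  (Unique.map⁺ ∷-injectiveʳ (box-unique (suc m) l)) disjoint
  where
  disjoint : Disjoint (box m (suc l)) (map (suc m ∷_) (box (suc m) l))
  disjoint (xs∈ˡ , xs∈ʳ) with ∈-map⁻ (suc m ∷_) xs∈ʳ
  ... | _ , _ , refl with box-sound m (suc l) xs∈ˡ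
  ...   | _ , _ , 1+m≤m ∷ _ , _ = ℕ.<-irrefl refl 1+m≤m

parts≤sum : ∀ xs → All (ℕ._≤ sum xs) xs
parts≤sum []       = []
parts≤sum (x ∷ xs) = ℕ.m≤m+n x (sum xs) ∷
  All.map (λ y≤ → ℕ.≤-trans y≤ (ℕ.m≤n+m (sum xs) x)) (parts≤sum xs)

length≤sum : ∀ xs → All (1 ℕ.≤_) xs → length xs ℕ.≤ sum xs
length≤sum []       _           = z≤n
length≤sum (x ∷ xs) (1≤x ∷ pos) = ℕ.+-mono-≤ 1≤x (length≤sum xs pos)

∈-partitions : ∀ n xs → xs ∈ partitions n ⇔ IsPartition n xs
∈-partitions n xs = mk⇔ sound complete
  where
  sound : xs ∈ partitions n → IsPartition n xs
  sound xs∈ with ∈-filter⁻ (λ ys → sum ys ℕ.≟ n) {xs = box n n} xs∈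
  ... | xs∈box , Σ≡n with box-sound n n xs∈box
  ...   | desc , pos , _ = desc , pos , Σ≡n
  complete : IsPartition n xs → xs ∈ partitions n
  complete (desc , pos , refl) = ∈-filter⁺ (λ ys → sum ys ℕ.≟ n)
    (box-complete n n xs (desc , pos , parts≤sum xs , length≤sum xs pos)) refl

partitions-unique : ∀ n → Unique (partitions n)
partitions-unique n = Unique.filter⁺ (λ ys → sum ys ℕ.≟ n) (box-unique n n)

{-# OPTIONS --safe #-}

-- Since f₄²/f₂² is f₂²/f₁² at q², EOᵤ(2n) is the coefficient of q^n in
-- f₂²/f₁² = (1/f₁) · (f₂²/f₁).  Here 1/f₁ generates p(n), and by Gauss
-- f₂²/f₁ = ∑ q^{k(k+1)/2}.  Gauss's identity is the limit of Shanks's finite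
-- identity, multiplied out so that it has no denominators,
--   ∑_{0≤s≤n} ∏_{s<j≤n} (1 - q^{2j}) ∏_{j≤s} (1 - q^{2j-1}) q^{s(2n+1)}
--     = ∏_{j≤n} (1 - q^{2j-1}) ∑_{0≤k≤2n} q^{k(k+1)/2},
-- whose terms with s ≥ 1 vanish modulo q^{2n+1}.
module Submission where

open import Defs
open import Data.Nat using (ℕ; _+_; _*_; _∸_; _/_)
open import Data.Integer using (+_)
open import Data.Fin using (toℕ)
open import Relation.Binary.PropositionalEquality using (_≡_)
open ℕ-Sum using (sum⁺-syntax)

open import Algebra.Bundles using (CommutativeRing)
open import Data.Fin.Properties using (toℕ-inject₁; toℕ-fromℕ)
open import Data.Integer using (0ℤ; 1ℤ)
import Data.Integer as ℤ
import Data.Integer.Properties as ℤ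
import Data.Integer.Tactic.RingSolver as ℤ using (solve-∀)
open import Data.List using (List; []; _∷_; _++_; map; filter; length)
open import Data.List.Properties using (filter-accept; filter-reject)
open import Data.Nat using (zero; suc; _≤_; _<_; z≤n; s≤s; s≤s⁻¹; NonZero)
open import Data.Nat.Divisibility using (_∣_; divides-refl; ∣m∣n⇒∣m+n)
open import Data.Nat.DivMod using (m*n/n≡m; m/n*n≡m)
open import Data.Nat.ListAction using (sum)
import Data.Nat.Properties as ℕ
import Data.Nat.Tactic.RingSolver as ℕ using (solve-∀)
open import Data.Product using (_,_)
open import Function.Bundles using (_⇔_; mk⇔; Equivalence)
open import Level using (0ℓ)
import Relation.Binary.PropositionalEquality as ≡
open import Relation.Nullary using (yes; no; contradiction)

-- Triangular numbers of even and odd index.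

triangle : ℕ → ℕ
triangle k = k * (k + 1) / 2

triangle-even : ∀ n → triangle (2 * n) ≡ n * suc (2 * n)
triangle-even n = ≡.trans (≡.cong (_/ 2) (lemma n)) (m*n/n≡m (n * suc (2 * n)) 2)
  where
  lemma : ∀ n → 2 * n * (2 * n + 1) ≡ n * suc (2 * n) * 2
  lemma = ℕ.solve-∀

triangle-odd : ∀ n → triangle (suc (2 * n)) ≡ suc (2 * n) * suc n
triangle-odd n = ≡.trans (≡.cong (_/ 2) (lemma n)) (m*n/n≡m (suc (2 * n) * suc n) 2)
  where
  lemma : ∀ n → suc (2 * n) * (suc (2 * n) + 1) ≡ suc (2 * n) * suc n * 2
  lemma = ℕ.solve-∀

-- Two identities in commutative rings.

module RingIdentities {c ℓ} (R : CommutativeRing c ℓ) where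
  open CommutativeRing R renaming (_+_ to _⊕_; _*_ to _⊛_)
  open import Relation.Binary.Reasoning.Setoid setoid
  open import Algebra.Solver.Ring.NaturalCoefficients.Default commutativeSemiring
    using (solve; _:=_; _:+_; _:*_)

  -- Shape of the inductive step of `box-series`: `f` is the product over part sizes up to `m`, `d`
  -- the next factor and `x` the monomial of a part `suc m`. The right-hand side isolates `f ⊛ g`
  -- and `f ⊛ d ⊛ h`, to which the induction hypotheses apply.
  *-distrib-recurrence : ∀ f d g x h → f ⊛ d ⊛ (g ⊕ x ⊛ h) ≈ d ⊛ (f ⊛ g) ⊕ x ⊛ (f ⊛ d ⊛ h)
  *-distrib-recurrence = solve 5
    (λ f d g x h → f :* d :* (g :+ x :* h) := d :* (f :* g) :+ x :* (f :* d :* h)) refl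

  -- Multiplying by `p` twice removes `f ⊛ f` on the left; on the right one `p` cancels `f` and the
  -- other remains. This turns f₂²/f₁² into a product with 1/f₁.
  divide-by-square : ∀ {x f p t} → p ⊛ f ≈ 1# → x ⊛ (f ⊛ f) ≈ f ⊛ t → x ≈ t ⊛ p
  divide-by-square {x} {f} {p} {t} pf≈1 xff≈ft = begin
    x                           ≈⟨ *-identityʳ x ⟨
    x ⊛ 1#                      ≈⟨ *-congˡ (*-identityʳ 1#) ⟨
    x ⊛ (1# ⊛ 1#)               ≈⟨ *-congˡ (*-cong pf≈1 pf≈1) ⟨
    x ⊛ (p ⊛ f ⊛ (p ⊛ f))       ≈⟨ solve 3 (λ x p f → x :* (p :* f :* (p :* f)) := x :* (f :* f) :* p :* p) refl x p f ⟩
    x ⊛ (f ⊛ f) ⊛ p ⊛ p         ≈⟨ *-congʳ (*-congʳ xff≈ft) ⟩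
    f ⊛ t ⊛ p ⊛ p               ≈⟨ solve 3 (λ f t p → f :* t :* p :* p := t :* p :* (p :* f)) refl f t p ⟩
    t ⊛ p ⊛ (p ⊛ f)             ≈⟨ *-congˡ pf≈1 ⟩
    t ⊛ p ⊛ 1#                  ≈⟨ *-identityʳ (t ⊛ p) ⟩
    t ⊛ p                       ∎

-- Shanks's finite form of Gauss's identity in a commutative ring.

module FiniteGauss {c ℓ} (R : CommutativeRing c ℓ) (q : CommutativeRing.Carrier R) where
  open CommutativeRing R renaming (_+_ to _⊕_; _*_ to _⊛_)
  open import Algebra.Properties.CommutativeSemiring.Exp commutativeSemiring
    using (_^_; ^-congˡ; ^-congʳ; ^-homo-*; ^-assocʳ; ^-distrib-*)
  open import Algebra.Properties.Ring ring using (-‿distribˡ-*)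
  open import Relation.Binary.Reasoning.Setoid setoid
  open import Algebra.Solver.Ring.NaturalCoefficients.Default commutativeSemiring
    using (solve; _:=_; _:+_; _:*_)

  1-_ : Carrier → Carrier
  1- x = 1# - x

  1-‿cong : ∀ {x y} → x ≈ y → 1- x ≈ 1- y
  1-‿cong x≈y = +-congˡ (-‿cong x≈y)

  -- Lets two factorisations of the same product be exchanged. The telescoping uses subtraction only
  -- through this lemma, since the semiring solver sees each `1- x` as an atom.
  complement-* : ∀ x y → (1- x) ⊛ y ⊕ (1- y) ≈ 1- (x ⊛ y)
  complement-* x y = begin
    (1- x) ⊛ y ⊕ (1- y)                       ≈⟨ +-congʳ (distribʳ y 1# (- x)) ⟩
    (1# ⊛ y ⊕ (- x) ⊛ y) ⊕ (1- y)            ≈⟨ +-congʳ (+-cong (*-identityˡ y) (sym (-‿distribˡ-* x y))) ⟩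
    (y ⊕ - (x ⊛ y)) ⊕ (1# ⊕ - y)             ≈⟨ solve 4 (λ a b c d → (a :+ b) :+ (c :+ d) := (a :+ d) :+ (c :+ b)) refl y (- (x ⊛ y)) 1# (- y) ⟩
    (y ⊕ - y) ⊕ (1# ⊕ - (x ⊛ y))             ≈⟨ +-congʳ (-‿inverseʳ y) ⟩
    0# ⊕ (1# ⊕ - (x ⊛ y))                    ≈⟨ +-identityˡ _ ⟩
    1- (x ⊛ y)                                ∎

  odds : ℕ → Carrier
  odds zero    = 1#
  odds (suc n) = odds n ⊛ (1- (q ^ suc (2 * n)))

  -- ∏_{s < j ≤ s + d} (1 - q^{2 j})
  evens : ℕ → ℕ → Carrier
  evens s zero    = 1#
  evens s (suc d) = (1- (q ^ (2 * suc s))) ⊛ evens (suc s) d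

  -- `evens` recurses on its lowest factor, in step with the recursion of `shanks` on `s`; passing
  -- from `n` to `suc n` adds a highest factor instead.
  evens-last : ∀ s d → evens s (suc d) ≈ evens s d ⊛ (1- (q ^ (2 * suc (s + d))))
  evens-last s zero    = trans (*-comm _ _)
    (*-congˡ (1-‿cong (^-congʳ q (≡.cong (λ m → 2 * suc m) (≡.sym (ℕ.+-identityʳ s))))))
  evens-last s (suc d) = begin
    (1- (q ^ (2 * suc s))) ⊛ evens (suc s) (suc d)
      ≈⟨ *-congˡ (evens-last (suc s) d) ⟩
    (1- (q ^ (2 * suc s))) ⊛ (evens (suc s) d ⊛ (1- (q ^ (2 * suc (suc s + d)))))
      ≈⟨ *-assoc _ _ _ ⟨
    evens s (suc d) ⊛ (1- (q ^ (2 * suc (suc s + d))))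
      ≈⟨ *-congˡ (1-‿cong (^-congʳ q (≡.cong (λ m → 2 * suc m) (≡.sym (ℕ.+-suc s d))))) ⟩
    evens s (suc d) ⊛ (1- (q ^ (2 * suc (s + suc d)))) ∎

  factors : ℕ → Carrier
  factors zero    = 1#
  factors (suc n) = factors n ⊛ (1- (q ^ suc n))

  factors-even : ∀ n → factors (2 * n) ≈ odds n ⊛ evens 0 n
  factors-even zero    = sym (*-identityʳ 1#)
  factors-even (suc n) = begin
    factors (2 * suc n)
      ≡⟨ ≡.cong factors (ℕ.*-suc 2 n) ⟩
    factors (2 * n) ⊛ A ⊛ (1- (q ^ (2 + 2 * n)))
      ≈⟨ *-cong (*-congʳ (factors-even n)) (1-‿cong (^-congʳ q (≡.sym (ℕ.*-suc 2 n)))) ⟩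
    odds n ⊛ evens 0 n ⊛ A ⊛ B
      ≈⟨ solve 4 (λ O E A B → O :* E :* A :* B := O :* A :* (E :* B)) refl (odds n) (evens 0 n) A B ⟩
    odds (suc n) ⊛ (evens 0 n ⊛ B)
      ≈⟨ *-congˡ (evens-last 0 n) ⟨
    odds (suc n) ⊛ evens 0 (suc n) ∎
    where
    A = 1- (q ^ suc (2 * n))
    B = 1- (q ^ (2 * suc n))

  -- ∑_{s ≤ i ≤ s + d} evens i (s + d - i) · odds i · y^i
  shanks : ℕ → ℕ → Carrier → Carrier
  shanks s zero    y = odds s ⊛ y ^ s
  shanks s (suc d) y = evens s (suc d) ⊛ odds s ⊛ y ^ s ⊕ shanks (suc s) d y

  shanks-cong : ∀ s d {x y} → x ≈ y → shanks s d x ≈ shanks s d y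
  shanks-cong s zero    x≈y = *-congˡ (^-congˡ s x≈y)
  shanks-cong s (suc d) x≈y = +-cong (*-congˡ (^-congˡ s x≈y)) (shanks-cong (suc s) d x≈y)

  q^2[1+n] : ∀ n → q ^ (2 * suc n) ≈ q ⊛ q ^ suc (2 * n)
  q^2[1+n] n = ^-congʳ q (ℕ.*-suc 2 n)

  [q²y]^ : ∀ y s → (q ^ 2 ⊛ y) ^ s ≈ q ^ (2 * s) ⊛ y ^ s
  [q²y]^ y s = trans (^-distrib-* (q ^ 2) y s) (*-congʳ (^-assocʳ q 2 s))

  -- shanks s (suc d) (q² y) - (1 - y) shanks s d y telescopes summand by
  -- summand; the term with 1 - q^{2s} is the lower end of the telescoping sum
  -- and vanishes for s = 0.
  shanks-telescope : ∀ d s {n} → s + d ≡ n → let y = q ^ suc (2 * n) in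
    shanks s (suc d) (q ^ 2 ⊛ y) ⊕ (1- (q ^ (2 * s))) ⊛ (evens s d ⊛ odds s ⊛ y ^ s) ≈
    (1- y) ⊛ shanks s d y ⊕ odds (suc n) ⊛ (y ^ suc n ⊕ (q ^ 2 ⊛ y) ^ suc n)
  shanks-telescope zero s s+0≡n with ≡.trans (≡.sym (ℕ.+-identityʳ s)) s+0≡n
  ... | ≡.refl = begin
    (A ⊛ 1# ⊛ O ⊛ (q ^ 2 ⊛ y) ^ s ⊕ O ⊛ D ⊛ Z) ⊕ C ⊛ (1# ⊛ O ⊛ w)
      ≈⟨ +-congʳ (+-congʳ (*-cong (*-congʳ (*-identityʳ A)) ([q²y]^ y s))) ⟩
    (A ⊛ O ⊛ (u ⊛ w) ⊕ O ⊛ D ⊛ Z) ⊕ C ⊛ (1# ⊛ O ⊛ w)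
      ≈⟨ +-congˡ (*-congˡ (*-congʳ (*-identityˡ O))) ⟩
    (A ⊛ O ⊛ (u ⊛ w) ⊕ O ⊛ D ⊛ Z) ⊕ C ⊛ (O ⊛ w)
      ≈⟨ solve 7 (λ A O u w D Z C →
           ((A :* O :* (u :* w)) :+ (O :* D :* Z)) :+ (C :* (O :* w)) :=
           ((O :* w :* ((A :* u) :+ C)) :+ (O :* D :* Z))) refl A O u w D Z C ⟩
    O ⊛ w ⊛ (A ⊛ u ⊕ C) ⊕ O ⊛ D ⊛ Z
      ≈⟨ +-congʳ (*-congˡ Au+C) ⟩
    O ⊛ w ⊛ (D ⊛ y ⊕ D) ⊕ O ⊛ D ⊛ Z
      ≈⟨ solve 5 (λ O w D y Z →
           ((O :* w :* ((D :* y) :+ D)) :+ (O :* D :* Z)) :=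
           ((D :* (O :* w)) :+ (O :* D :* ((y :* w) :+ Z)))) refl O w D y Z ⟩
    D ⊛ (O ⊛ w) ⊕ O ⊛ D ⊛ (y ⊛ w ⊕ Z) ∎
    where
    u = q ^ (2 * s)
    y = q ^ suc (2 * s)
    A = 1- (q ^ (2 * suc s))
    O = odds s
    w = y ^ s
    C = 1- u
    D = 1- y
    Z = (q ^ 2 ⊛ y) ^ suc s
    -- Both sides are `1- (y ⊛ y)`, as 2s + 2 and 2s, with the additional 0 and 2s of neither left
    -- over, add up to twice 2s + 1. Since s = n here, the part `D ⊛ y` supplies the term
    -- `y ^ suc n`.
    Au+C : A ⊛ u ⊕ C ≈ D ⊛ y ⊕ D
    Au+C = begin
      A ⊛ u ⊕ C  ≈⟨ complement-* _ u ⟩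
      1- (q ^ (2 * suc s) ⊛ u)
        ≈⟨ 1-‿cong (trans (*-congʳ (q^2[1+n] s))
             (solve 3 (λ q y u → q :* y :* u := y :* (q :* u)) refl q y u)) ⟩
      1- (y ⊛ y) ≈⟨ complement-* y y ⟨
      D ⊛ y ⊕ D  ∎
  shanks-telescope (suc d) s {n} s+1+d≡n = begin
    (A ⊛ evens (suc s) (suc d) ⊛ O ⊛ (q ^ 2 ⊛ y) ^ s ⊕ X) ⊕ C ⊛ (A ⊛ E ⊛ O ⊛ w)
      ≈⟨ +-congʳ (+-congʳ (*-cong (*-congʳ (*-congˡ evens≈)) ([q²y]^ y s))) ⟩
    (A ⊛ (E ⊛ B) ⊛ O ⊛ (u ⊛ w) ⊕ X) ⊕ C ⊛ (A ⊛ E ⊛ O ⊛ w)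
      ≈⟨ solve 8 (λ A E B O u w X C →
           (((A :* (E :* B) :* O :* (u :* w)) :+ X) :+ (C :* (A :* E :* O :* w))) :=
           ((A :* E :* O :* w :* ((B :* u) :+ C)) :+ X)) refl A E B O u w X C ⟩
    A ⊛ E ⊛ O ⊛ w ⊛ (B ⊛ u ⊕ C) ⊕ X
      ≈⟨ +-congʳ (*-congˡ Bu+C) ⟩
    A ⊛ E ⊛ O ⊛ w ⊛ (F ⊛ y ⊕ D) ⊕ X
      ≈⟨ solve 8 (λ A E O w F y D X →
           ((A :* E :* O :* w :* ((F :* y) :+ D)) :+ X) :=
           ((D :* (A :* E :* O :* w)) :+ (X :+ (A :* (E :* (O :* F) :* (y :* w)))))) refl A E O w F y D X ⟩
    D ⊛ (A ⊛ E ⊛ O ⊛ w) ⊕ (X ⊕ A ⊛ (E ⊛ (O ⊛ F) ⊛ (y ⊛ w)))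
      -- `O ⊛ F` is `odds (suc s)` and `y ⊛ w` is `y ^ suc s`, so the surplus next to `X` is exactly
      -- the lower end of the telescoping sum at `suc s`.
      ≈⟨ +-congˡ (shanks-telescope d (suc s) 1+s+d≡n) ⟩
    D ⊛ (A ⊛ E ⊛ O ⊛ w) ⊕ (D ⊛ X′ ⊕ Z)
      ≈⟨ solve 4 (λ D a X′ Z → ((D :* a) :+ ((D :* X′) :+ Z)) := ((D :* (a :+ X′)) :+ Z)) refl D (A ⊛ E ⊛ O ⊛ w) X′ Z ⟩
    D ⊛ (A ⊛ E ⊛ O ⊛ w ⊕ X′) ⊕ Z ∎
    where
    1+s+d≡n : suc s + d ≡ n
    1+s+d≡n = ≡.trans (≡.sym (ℕ.+-suc s d)) s+1+d≡n
    u = q ^ (2 * s)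
    y = q ^ suc (2 * n)
    A = 1- (q ^ (2 * suc s))
    B = 1- (q ⊛ y)
    E = evens (suc s) d
    O = odds s
    w = y ^ s
    C = 1- u
    D = 1- y
    F = 1- (q ⊛ u)
    X = shanks (suc s) (suc d) (q ^ 2 ⊛ y)
    X′ = shanks (suc s) d y
    Z = odds (suc n) ⊛ (y ^ suc n ⊕ (q ^ 2 ⊛ y) ^ suc n)
    evens≈ : evens (suc s) (suc d) ≈ E ⊛ B
    evens≈ = trans (evens-last (suc s) d)
      (*-congˡ (1-‿cong (trans (^-congʳ q (≡.cong (λ m → 2 * suc m) 1+s+d≡n)) (q^2[1+n] n))))
    -- Both sides are `1- (q ⊛ u ⊛ y)`: the top factor `B` of `evens` is traded for the next factor
    -- `F` of `odds`.
    Bu+C : B ⊛ u ⊕ C ≈ F ⊛ y ⊕ D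
    Bu+C = begin
      B ⊛ u ⊕ C          ≈⟨ complement-* _ u ⟩
      1- (q ⊛ y ⊛ u)     ≈⟨ 1-‿cong (solve 3 (λ q y u → q :* y :* u := q :* u :* y) refl q y u) ⟩
      1- (q ⊛ u ⊛ y)     ≈⟨ complement-* _ y ⟨
      F ⊛ y ⊕ D          ∎

  triangular : ℕ → Carrier
  triangular zero    = 1#
  triangular (suc K) = triangular K ⊕ q ^ triangle (suc K)

  shanks-step : ∀ n → let y = q ^ suc (2 * n) in
    shanks 0 (suc n) (q ^ 2 ⊛ y) ≈
    (1- y) ⊛ shanks 0 n y ⊕ odds (suc n) ⊛ (y ^ suc n ⊕ (q ^ 2 ⊛ y) ^ suc n)
  shanks-step n = begin
    S                                          ≈⟨ +-identityʳ S ⟨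
    S ⊕ 0#                                     ≈⟨ +-congˡ (zeroˡ t) ⟨
    S ⊕ 0# ⊛ t                                 ≈⟨ +-congˡ (*-congʳ (-‿inverseʳ 1#)) ⟨
    S ⊕ (1- 1#) ⊛ t                            ≈⟨ shanks-telescope n 0 ≡.refl ⟩
    _                                          ∎
    where
    S = shanks 0 (suc n) (q ^ 2 ⊛ q ^ suc (2 * n))
    t = evens 0 n ⊛ 1# ⊛ 1#

  -- Induction on `n` by `shanks-step`. The factor `1- y` extends `odds n`, and the two extra powers
  -- are the next two triangular monomials, because (2n+1)(n+1) and (n+1)(2n+3) are the triangular
  -- numbers of index 2n+1 and 2n+2.
  shanks-identity : ∀ n → shanks 0 n (q ^ suc (2 * n)) ≈ odds n ⊛ triangular (2 * n)
  shanks-identity zero    = refl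
  shanks-identity (suc n) = begin
    shanks 0 (suc n) (q ^ suc (2 * suc n))
      ≈⟨ shanks-cong 0 (suc n) q²y ⟨
    shanks 0 (suc n) (q ^ 2 ⊛ y)
      ≈⟨ shanks-step n ⟩
    D ⊛ shanks 0 n y ⊕ O ⊛ D ⊛ (y ^ suc n ⊕ (q ^ 2 ⊛ y) ^ suc n)
      ≈⟨ +-cong (*-congˡ (shanks-identity n)) (*-congˡ (+-cong powₒ powₑ)) ⟩
    D ⊛ (O ⊛ t) ⊕ O ⊛ D ⊛ (a ⊕ b)
      ≈⟨ solve 5 (λ D O t a b →
           ((D :* (O :* t)) :+ (O :* D :* (a :+ b))) :=
           (O :* D :* ((t :+ a) :+ b))) refl D O t a b ⟩
    O ⊛ D ⊛ triangular (suc (suc (2 * n)))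
      ≡⟨ ≡.cong (λ m → O ⊛ D ⊛ triangular m) (≡.sym (ℕ.*-suc 2 n)) ⟩
    odds (suc n) ⊛ triangular (2 * suc n) ∎
    where
    y = q ^ suc (2 * n)
    D = 1- y
    O = odds n
    t = triangular (2 * n)
    a = q ^ triangle (suc (2 * n))
    b = q ^ triangle (suc (suc (2 * n)))
    q²y : q ^ 2 ⊛ y ≈ q ^ suc (2 * suc n)
    q²y = trans (sym (^-homo-* q 2 (suc (2 * n))))
      (^-congʳ q (≡.cong suc (≡.sym (ℕ.*-suc 2 n))))
    powₒ : y ^ suc n ≈ a
    powₒ = trans (^-assocʳ q (suc (2 * n)) (suc n)) (^-congʳ q (≡.sym (triangle-odd n)))
    powₑ : (q ^ 2 ⊛ y) ^ suc n ≈ b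
    powₑ = begin
      (q ^ 2 ⊛ y) ^ suc n                ≈⟨ ^-congˡ (suc n) q²y ⟩
      (q ^ suc (2 * suc n)) ^ suc n      ≈⟨ ^-assocʳ q (suc (2 * suc n)) (suc n) ⟩
      q ^ (suc (2 * suc n) * suc n)      ≡⟨ ≡.cong (q ^_) (ℕ.*-comm (suc (2 * suc n)) (suc n)) ⟩
      q ^ (suc n * suc (2 * suc n))      ≡⟨ ≡.cong (q ^_) (triangle-even (suc n)) ⟨
      q ^ triangle (2 * suc n)           ≡⟨ ≡.cong (λ m → q ^ triangle m) (ℕ.*-suc 2 n) ⟩
      b                                  ∎

  -- Every summand carries a positive power of `y`.
  shanks-0 : ∀ s d → shanks (suc s) d 0# ≈ 0#
  shanks-0 s zero    = trans (*-congˡ (zeroˡ _)) (zeroʳ _)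
  shanks-0 s (suc d) = trans
    (+-cong (trans (*-congˡ (zeroˡ _)) (zeroʳ _)) (shanks-0 (suc s) d))
    (+-identityˡ 0#)

  -- The hypothesis is the form in which truncation modulo a power of `q` enters an abstract ring:
  -- it leaves only the summand of index 0 of `shanks`.
  evens≈odds*triangular : ∀ n → q ^ suc (2 * n) ≈ 0# → evens 0 n ≈ odds n ⊛ triangular (2 * n)
  evens≈odds*triangular n y≈0 = begin
    evens 0 n                      ≈⟨ evens≈shanks n ⟩
    shanks 0 n 0#                  ≈⟨ shanks-cong 0 n y≈0 ⟨
    shanks 0 n (q ^ suc (2 * n))   ≈⟨ shanks-identity n ⟩
    odds n ⊛ triangular (2 * n)    ∎
    where
    evens≈shanks : ∀ n → evens 0 n ≈ shanks 0 n 0#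
    evens≈shanks zero    = sym (*-identityʳ 1#)
    evens≈shanks (suc n) = begin
      evens 0 (suc n)
        ≈⟨ trans (*-identityʳ _) (*-identityʳ _) ⟨
      evens 0 (suc n) ⊛ 1# ⊛ 1#
        ≈⟨ +-identityʳ _ ⟨
      evens 0 (suc n) ⊛ 1# ⊛ 1# ⊕ 0#
        ≈⟨ +-congˡ (shanks-0 0 n) ⟨
      shanks 0 (suc n) 0# ∎

  -- Multiplying by a second `evens 0 n` completes `odds n` to the full product `factors (2 * n)`,
  -- so nothing has to be inverted.
  gauss : ∀ n → q ^ suc (2 * n) ≈ 0# → evens 0 n ⊛ evens 0 n ≈ factors (2 * n) ⊛ triangular (2 * n)
  gauss n y≈0 = begin
    evens 0 n ⊛ evens 0 n          ≈⟨ *-congʳ (evens≈odds*triangular n y≈0) ⟩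
    odds n ⊛ T ⊛ evens 0 n         ≈⟨ solve 3 (λ O T E → O :* T :* E := O :* E :* T) refl (odds n) T (evens 0 n) ⟩
    odds n ⊛ evens 0 n ⊛ T         ≈⟨ *-congʳ (factors-even n) ⟨
    factors (2 * n) ⊛ T            ∎
    where T = triangular (2 * n)

open ≡ using (_≗_; refl; sym; trans; cong; cong₂; module ≡-Reasoning)
open ℕ-Sum using (sum-cong-≗; sum-init-last)

-- Power series as a commutative ring up to a given degree.

tail : Series → Series
tail a n = a (suc n)

infixl 6 _⊕_

_⊕_ : Series → Series → Series
(a ⊕ b) n = a n ℤ.+ b n

⊖_ : Series → Series
(⊖ a) n = ℤ.- a n

0ₛ : Series
0ₛ _ = 0ℤ

infix 4 _≈[_]_

-- A record, since unification would η-expand a bare function type and lose a and b.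
record _≈[_]_ (a : Series) (N : ℕ) (b : Series) : Set where
  constructor agree
  field coeff : ∀ {n} → n ≤ N → a n ≡ b n

open _≈[_]_

≗⇒≈ : ∀ {a b N} → a ≗ b → a ≈[ N ] b
≗⇒≈ a≗b = agree λ {n} _ → a≗b n

-- A coefficient of index at most `N` in a product reads only coefficients of index at most `N` in
-- the factors.
·-cong : ∀ {a a′ b b′ N} → a ≈[ N ] a′ → b ≈[ N ] b′ → a · b ≈[ N ] a′ · b′
·-cong a≈ b≈ = agree (go a≈ b≈)
  where
  go : ∀ {a a′ b b′ N} → a ≈[ N ] a′ → b ≈[ N ] b′ → ∀ {n} → n ≤ N → (a · b) n ≡ (a′ · b′) n
  go a≈ b≈ {zero} _ = cong (ℤ._+ 0ℤ) (cong₂ ℤ._*_ (coeff a≈ z≤n) (coeff b≈ z≤n))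
  go {N = suc N} a≈ b≈ {suc n} 1+n≤@(s≤s n≤) = cong₂ ℤ._+_
    (cong₂ ℤ._*_ (coeff a≈ z≤n) (coeff b≈ 1+n≤))
    (go {N = N} (agree (λ i≤ → coeff a≈ (s≤s i≤)))
      (agree (λ i≤N → coeff b≈ (ℕ.m≤n⇒m≤1+n i≤N))) n≤)

·-cong-≗ : ∀ {a a′ b b′} → a ≗ a′ → b ≗ b′ → a · b ≗ a′ · b′
·-cong-≗ a≗ b≗ n = coeff (·-cong (≗⇒≈ a≗) (≗⇒≈ b≗)) ℕ.≤-refl

add-congˡ : ∀ x {y z} → y ≡ z → x ℤ.+ y ≡ x ℤ.+ z
add-congˡ x = cong (λ y → x ℤ.+ y)

0-· : ∀ a → 0ₛ · a ≗ 0ₛ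
0-· a zero    = refl
0-· a (suc n) = trans (ℤ.+-identityˡ _) (0-· a n)

1-· : ∀ a → q^ 0 · a ≗ a
1-· a zero    = trans (ℤ.+-identityʳ _) (ℤ.*-identityˡ _)
1-· a (suc n) = trans (cong₂ ℤ._+_ (ℤ.*-identityˡ (a (suc n))) (0-· a n)) (ℤ.+-identityʳ _)

-- The convolution unfolds by consuming its left factor; this mirror image, consuming the right
-- factor, is what commutativity needs.
·-suc : ∀ a b n → (a · b) (suc n) ≡ (a · tail b) n ℤ.+ a (suc n) ℤ.* b 0
·-suc a b zero    = lemma (a 0 ℤ.* b 1) (a 1 ℤ.* b 0)
  where
  lemma : ∀ x y → x ℤ.+ (y ℤ.+ 0ℤ) ≡ x ℤ.+ 0ℤ ℤ.+ y
  lemma = ℤ.solve-∀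
·-suc a b (suc n) =
  trans (add-congˡ (a 0 ℤ.* b (2 + n)) (·-suc (tail a) b n)) (sym (ℤ.+-assoc (a 0 ℤ.* b (suc (suc n))) _ _))

·-comm : ∀ a b → a · b ≗ b · a
·-comm a b zero    = cong (ℤ._+ 0ℤ) (ℤ.*-comm (a 0) (b 0))
·-comm a b (suc n) = trans
  (cong₂ ℤ._+_ (ℤ.*-comm (a 0) (b (suc n))) (·-comm (tail a) b n))
  (trans (ℤ.+-comm (b (suc n) ℤ.* a 0) _) (sym (·-suc b a n)))

·-distribʳ : ∀ c a b → (a ⊕ b) · c ≗ a · c ⊕ b · c
·-distribʳ c a b zero    = lemma (a 0) (b 0) (c 0)
  where
  lemma : ∀ x y z → (x ℤ.+ y) ℤ.* z ℤ.+ 0ℤ ≡ x ℤ.* z ℤ.+ 0ℤ ℤ.+ (y ℤ.* z ℤ.+ 0ℤ)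
  lemma = ℤ.solve-∀
·-distribʳ c a b (suc n) = trans
  (add-congˡ ((a 0 ℤ.+ b 0) ℤ.* c (suc n)) (·-distribʳ c (tail a) (tail b) n))
  (lemma (a 0) (b 0) (c (suc n)) _ _)
  where
  lemma : ∀ x y z u v → (x ℤ.+ y) ℤ.* z ℤ.+ (u ℤ.+ v) ≡ x ℤ.* z ℤ.+ u ℤ.+ (y ℤ.* z ℤ.+ v)
  lemma = ℤ.solve-∀

·-scale : ∀ x a b n → ((λ i → x ℤ.* a i) · b) n ≡ x ℤ.* (a · b) n
·-scale x a b zero    = lemma x (a 0) (b 0)
  where
  lemma : ∀ x y z → x ℤ.* y ℤ.* z ℤ.+ 0ℤ ≡ x ℤ.* (y ℤ.* z ℤ.+ 0ℤ)
  lemma = ℤ.solve-∀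
·-scale x a b (suc n) = trans
  (add-congˡ (x ℤ.* a 0 ℤ.* b (suc n)) (·-scale x (tail a) b n))
  (lemma x (a 0) (b (suc n)) _)
  where
  lemma : ∀ x y z u → x ℤ.* y ℤ.* z ℤ.+ x ℤ.* u ≡ x ℤ.* (y ℤ.* z ℤ.+ u)
  lemma = ℤ.solve-∀

·-assoc : ∀ a b c → (a · b) · c ≗ a · (b · c)
·-assoc a b c zero    = lemma (a 0) (b 0) (c 0)
  where
  lemma : ∀ x y z → (x ℤ.* y ℤ.+ 0ℤ) ℤ.* z ℤ.+ 0ℤ ≡ x ℤ.* (y ℤ.* z ℤ.+ 0ℤ) ℤ.+ 0ℤ
  lemma = ℤ.solve-∀
·-assoc a b c (suc n) = begin
  (a · b) 0 ℤ.* c (suc n) ℤ.+ (tail (a · b) · c) n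
    -- By unfolding, `tail (a · b)` is `a 0` times `tail b` plus `tail a · b`.
    ≡⟨ add-congˡ ((a · b) 0 ℤ.* c (suc n)) (·-distribʳ c (λ i → a 0 ℤ.* b (suc i)) (tail a · b) n) ⟩
  (a · b) 0 ℤ.* c (suc n) ℤ.+ (((λ i → a 0 ℤ.* b (suc i)) · c) n ℤ.+ ((tail a · b) · c) n)
    ≡⟨ add-congˡ ((a · b) 0 ℤ.* c (suc n)) (cong₂ ℤ._+_ (·-scale (a 0) (tail b) c n) (·-assoc (tail a) b c n)) ⟩
  (a · b) 0 ℤ.* c (suc n) ℤ.+ (a 0 ℤ.* (tail b · c) n ℤ.+ (tail a · (b · c)) n)
    ≡⟨ lemma (a 0) (b 0) (c (suc n)) _ _ ⟩
  a 0 ℤ.* (b · c) (suc n) ℤ.+ (tail a · (b · c)) n ∎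
  where
  open ≡-Reasoning
  lemma : ∀ x y z u v → (x ℤ.* y ℤ.+ 0ℤ) ℤ.* z ℤ.+ (x ℤ.* u ℤ.+ v) ≡ x ℤ.* (y ℤ.* z ℤ.+ u) ℤ.+ v
  lemma = ℤ.solve-∀

-- ℤ[[q]] / (q^{N+1})
truncated : ℕ → CommutativeRing 0ℓ 0ℓ
truncated N = record
  { Carrier = Series
  ; _≈_     = _≈[ N ]_
  ; _+_     = _⊕_
  ; _*_     = _·_
  ; -_      = ⊖_
  ; 0#      = 0ₛ
  ; 1#      = q^ 0
  ; isCommutativeRing = record
    { isRing = record
      { +-isAbelianGroup = record
        { isGroup = record
          { isMonoid = record
            { isSemigroup = record
              { isMagma = record
                { isEquivalence = record
                  { refl  = ≗⇒≈ λ _ → refl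
                  ; sym   = λ a≈b → agree λ n≤ → sym (coeff a≈b n≤)
                  ; trans = λ a≈b b≈c → agree λ n≤ → trans (coeff a≈b n≤) (coeff b≈c n≤)
                  }
                ; ∙-cong = λ a≈ b≈ → agree λ n≤ → cong₂ ℤ._+_ (coeff a≈ n≤) (coeff b≈ n≤)
                }
              ; assoc = λ a b c → ≗⇒≈ λ n → ℤ.+-assoc (a n) (b n) (c n)
              }
            ; identity = (λ a → ≗⇒≈ λ n → ℤ.+-identityˡ (a n))
                       , (λ a → ≗⇒≈ λ n → ℤ.+-identityʳ (a n))
            }
          ; inverse = (λ a → ≗⇒≈ λ n → ℤ.+-inverseˡ (a n))
                    , (λ a → ≗⇒≈ λ n → ℤ.+-inverseʳ (a n))
          ; ⁻¹-cong = λ a≈ → agree λ n≤ → cong ℤ.-_ (coeff a≈ n≤)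
          }
        ; comm = λ a b → ≗⇒≈ λ n → ℤ.+-comm (a n) (b n)
        }
      ; *-cong     = ·-cong
      ; *-assoc    = λ a b c → ≗⇒≈ (·-assoc a b c)
      ; *-identity = (λ a → ≗⇒≈ (1-· a))
                   , (λ a → ≗⇒≈ λ n → trans (·-comm a (q^ 0) n) (1-· a n))
      ; distrib    = (λ a b c → ≗⇒≈ λ n → trans (·-comm a (b ⊕ c) n)
                       (trans (·-distribʳ a b c n) (cong₂ ℤ._+_ (·-comm b a n) (·-comm c a n))))
                   , (λ a b c → ≗⇒≈ (·-distribʳ a b c))
      }
    ; *-comm = λ a b → ≗⇒≈ (·-comm a b)
    }
  }

-- Monomials, the products `f k`, and quotients.

q^-suc : ∀ m → tail (q^ (suc m)) ≗ q^ m
q^-suc m n with suc n ℕ.≟ suc m | n ℕ.≟ m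
... | yes _ | yes _ = refl
... | no _  | no _  = refl
... | yes p | no ¬p = contradiction (ℕ.suc-injective p) ¬p
... | no ¬p | yes p = contradiction (cong suc p) ¬p

q^-·-suc : ∀ m a n → (q^ (suc m) · a) (suc n) ≡ (q^ m · a) n
q^-·-suc m a n = trans (ℤ.+-identityˡ _) (·-cong-≗ {b = a} (q^-suc m) (λ _ → refl) n)

q^-·-≥ : ∀ m a {n} → m ≤ n → (q^ m · a) n ≡ a (n ∸ m)
q^-·-≥ zero    a z≤n                   = 1-· a _
q^-·-≥ (suc m) a {suc n} (s≤s m≤n) = trans (q^-·-suc m a n) (q^-·-≥ m a m≤n)

q^-·-< : ∀ m a {n} → n < m → (q^ m · a) n ≡ 0ℤ
q^-·-< (suc m) a {zero}  _         = refl
q^-·-< (suc m) a {suc n} (s≤s n<m) = trans (q^-·-suc m a n) (q^-·-< m a n<m)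

q^-·-q^ : ∀ m n → q^ m · q^ n ≗ q^ (m + n)
q^-·-q^ zero    n k       = 1-· (q^ n) k
q^-·-q^ (suc m) n zero    = refl
q^-·-q^ (suc m) n (suc k) = trans (q^-·-suc m (q^ n) k)
  (trans (q^-·-q^ m n k) (sym (q^-suc (m + n) k)))

q^-< : ∀ m {n} → n < m → q^ m n ≡ 0ℤ
q^-< (suc m) {zero}  _         = refl
q^-< (suc m) {suc n} (s≤s n<m) = trans (q^-suc m n) (q^-< m n<m)

-- A positive power of q gains a degree of precision, which lets `box-series` use its hypothesis for
-- `l` in degree `suc l`.
q^-·-lift : ∀ m {a b N} → a ≈[ N ] b → q^ (suc m) · a ≈[ suc N ] q^ (suc m) · b
q^-·-lift m {a} {b} {N} a≈b = agree lift
  where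
  lift : ∀ {n} → n ≤ suc N → (q^ (suc m) · a) n ≡ (q^ (suc m) · b) n
  lift {zero}  _        = refl
  lift {suc n} (s≤s n≤) = trans (q^-·-suc m a n)
    (trans (coeff (·-cong {q^ m} (≗⇒≈ λ _ → refl) a≈b) n≤) (sym (q^-·-suc m b n)))

-- `f k` takes each coefficient from a different partial product; by `f-stable` a single one serves
-- all degrees up to `n`.
f≈ : ∀ k .{{_ : NonZero k}} {n N} → n ≤ N → f k ≈[ n ] f-partial k N
f≈ k {n} {N} n≤N = agree λ {i} i≤n → sym (trans
  (cong (λ M → f-partial k M i) (sym (ℕ.m∸n+n≡m (ℕ.≤-trans i≤n n≤N))))
  (f-stable k i (N ∸ i)))

-- Follows the long division: the constant terms agree since `b 0` is 1, and `tail x` is again a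
-- quotient by `b`, of the series on which `divide` recurses.
divide-unique : ∀ x a b (b₀≡1 : b 0 ≡ 1ℤ) → x · b ≗ a → x ≗ divide a b b₀≡1
divide-unique x a b b₀≡1 x·b≗a zero = begin
  x 0               ≡⟨ ℤ.*-identityʳ (x 0) ⟨
  x 0 ℤ.* 1ℤ        ≡⟨ cong (x 0 ℤ.*_) b₀≡1 ⟨
  x 0 ℤ.* b 0       ≡⟨ ℤ.+-identityʳ _ ⟨
  x 0 ℤ.* b 0 ℤ.+ 0ℤ ≡⟨ x·b≗a 0 ⟩
  a 0               ∎
  where open ≡-Reasoning
divide-unique x a b b₀≡1 x·b≗a (suc n) = divide-unique (tail x) _ b b₀≡1 quotient n
  where
  open ≡-Reasoning
  cancel : ∀ u v → v ≡ u ℤ.+ v ℤ.- u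
  cancel = ℤ.solve-∀
  quotient : ∀ m → (tail x · b) m ≡ a (suc m) ℤ.- a 0 ℤ.* b (suc m)
  quotient m = begin
    (tail x · b) m
      ≡⟨ cancel (x 0 ℤ.* b (suc m)) _ ⟩
    (x · b) (suc m) ℤ.- x 0 ℤ.* b (suc m)
      ≡⟨ cong₂ (λ u v → u ℤ.- v ℤ.* b (suc m)) (x·b≗a (suc m))
           (divide-unique x a b b₀≡1 x·b≗a 0) ⟩
    a (suc m) ℤ.- a 0 ℤ.* b (suc m) ∎

-- Dilation and the even coefficients of `EOᵤ`.

-- The substitution q ↦ q².
dilate : Series → Series
dilate a zero          = a 0
dilate a (suc zero)    = 0ℤ
dilate a (suc (suc n)) = dilate (tail a) n

dilate-even : ∀ a n → dilate a (2 * n) ≡ a n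
dilate-even a zero    = refl
dilate-even a (suc n) = trans (cong (dilate a) (ℕ.*-suc 2 n)) (dilate-even (tail a) n)

dilate-cong : ∀ {a b} n → a ≈[ n ] b → dilate a n ≡ dilate b n
dilate-cong zero          a≈b = coeff a≈b z≤n
dilate-cong (suc zero)    a≈b = refl
dilate-cong (suc (suc n)) a≈b =
  dilate-cong n (agree λ i≤n → coeff a≈b (s≤s (ℕ.m≤n⇒m≤1+n i≤n)))

dilate-⊕ : ∀ a b → dilate (a ⊕ b) ≗ dilate a ⊕ dilate b
dilate-⊕ a b zero          = refl
dilate-⊕ a b (suc zero)    = refl
dilate-⊕ a b (suc (suc n)) = dilate-⊕ (tail a) (tail b) n

dilate-⊖ : ∀ a → dilate (⊖ a) ≗ ⊖ dilate a
dilate-⊖ a zero          = refl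
dilate-⊖ a (suc zero)    = refl
dilate-⊖ a (suc (suc n)) = dilate-⊖ (tail a) n

dilate-scale : ∀ x a n → dilate (λ i → x ℤ.* a i) n ≡ x ℤ.* dilate a n
dilate-scale x a zero          = refl
dilate-scale x a (suc zero)    = sym (ℤ.*-zeroʳ x)
dilate-scale x a (suc (suc n)) = dilate-scale x (tail a) n

-- Odd coefficients of a dilated series vanish, so the convolution can recurse two indices at a
-- time.
dilate-· : ∀ a b → dilate (a · b) ≗ dilate a · dilate b
dilate-· a b zero          = refl
dilate-· a b (suc zero)    = sym (trans (ℤ.+-identityʳ _) (ℤ.*-zeroʳ (a 0)))
dilate-· a b (suc (suc n)) = begin
  dilate ((λ i → a 0 ℤ.* b (suc i)) ⊕ tail a · b) n
    ≡⟨ dilate-⊕ (λ i → a 0 ℤ.* b (suc i)) (tail a · b) n ⟩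
  dilate (λ i → a 0 ℤ.* b (suc i)) n ℤ.+ dilate (tail a · b) n
    ≡⟨ cong₂ ℤ._+_ (dilate-scale (a 0) (tail b) n) (dilate-· (tail a) b n) ⟩
  a 0 ℤ.* dilate b (2 + n) ℤ.+ (dilate (tail a) · dilate b) n
    -- The restored zero is the product with the coefficient of index 1 of `dilate a`.
    ≡⟨ add-congˡ (a 0 ℤ.* dilate b (2 + n)) (ℤ.+-identityˡ _) ⟨
  (dilate a · dilate b) (2 + n) ∎
  where open ≡-Reasoning

dilate-0 : ∀ n → dilate 0ₛ n ≡ 0ℤ
dilate-0 zero          = refl
dilate-0 (suc zero)    = refl
dilate-0 (suc (suc n)) = dilate-0 n

dilate-q^ : ∀ m → dilate (q^ m) ≗ q^ (2 * m)
dilate-q^ zero    zero          = refl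
dilate-q^ zero    (suc zero)    = refl
dilate-q^ zero    (suc (suc n)) = dilate-0 n
dilate-q^ (suc m) zero          = refl
-- The inequality 2 · 1 ≤ 2 · (m + 1) is read as 1 < 2 · (m + 1).
dilate-q^ (suc m) (suc zero)    = sym (q^-< (2 * suc m) (ℕ.*-monoʳ-≤ 2 (s≤s (z≤n {m}))))
dilate-q^ (suc m) (suc (suc n)) = begin
  dilate (tail (q^ (suc m))) n  ≡⟨ dilate-cong n (≗⇒≈ (q^-suc m)) ⟩
  dilate (q^ m) n               ≡⟨ dilate-q^ m n ⟩
  q^ (2 * m) n                  ≡⟨ q^-suc (2 * m) n ⟨
  q^ (1 + 2 * m) (1 + n)        ≡⟨ q^-suc (1 + 2 * m) (1 + n) ⟨
  q^ (2 + 2 * m) (2 + n)        ≡⟨ cong (λ k → q^ k (2 + n)) (ℕ.*-suc 2 m) ⟨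
  q^ (2 * suc m) (2 + n)        ∎
  where open ≡-Reasoning

dilate-1-q^ : ∀ m → dilate (1-q^ m) ≗ 1-q^ (2 * m)
dilate-1-q^ m n = trans (dilate-⊕ (q^ 0) (⊖ q^ m) n)
  (cong₂ ℤ._+_ (dilate-q^ 0 n) (trans (dilate-⊖ (q^ m) n) (cong ℤ.-_ (dilate-q^ m n))))

dilate-f-partial : ∀ k N → dilate (f-partial k N) ≗ f-partial (2 * k) N
dilate-f-partial k zero    n = dilate-q^ 0 n
dilate-f-partial k (suc N) n = trans (dilate-· (f-partial k N) (1-q^ (k * suc N)) n)
  (·-cong-≗ (dilate-f-partial k N)
    (λ i → trans (dilate-1-q^ (k * suc N) i)
      (cong (λ m → 1-q^ m i) (sym (ℕ.*-assoc 2 k (suc N)))))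
    n)

dilate-f² : ∀ k .{{_ : NonZero k}} .{{_ : NonZero (2 * k)}} →
            dilate (f k · f k) ≗ f (2 * k) · f (2 * k)
dilate-f² k n = trans (dilate-· (f k) (f k) n) (·-cong-≗ f₂ₖ f₂ₖ n)
  where
  f₂ₖ : dilate (f k) ≗ f (2 * k)
  f₂ₖ i = trans (dilate-cong i (f≈ k ℕ.≤-refl)) (dilate-f-partial k i i)

EOᵤ-half : Series
EOᵤ-half = divide (f 2 · f 2) (f 1 · f 1) refl

-- By uniqueness of quotients it suffices to multiply by f₂², which is itself a dilation;
-- multiplicativity of `dilate` then gives f₄².
EOᵤ≗dilate : dilate EOᵤ-half ≗ EOᵤ
EOᵤ≗dilate = divide-unique (dilate EOᵤ-half) (f 4 · f 4) (f 2 · f 2) refl λ n → begin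
  (dilate EOᵤ-half · (f 2 · f 2)) n
    ≡⟨ ·-cong-≗ {dilate EOᵤ-half} (λ _ → refl) (dilate-f² 1) n ⟨
  (dilate EOᵤ-half · dilate (f 1 · f 1)) n
    ≡⟨ dilate-· EOᵤ-half (f 1 · f 1) n ⟨
  dilate (EOᵤ-half · (f 1 · f 1)) n
    ≡⟨ dilate-cong n (≗⇒≈ (divide-correct (f 2 · f 2) (f 1 · f 1) refl)) ⟩
  dilate (f 2 · f 2) n
    ≡⟨ dilate-f² 2 n ⟩
  (f 4 · f 4) n ∎
  where open ≡-Reasoning

-- The generating function of `p`.

∑q^sum : List (List ℕ) → Series
∑q^sum []         = 0ₛ
∑q^sum (xs ∷ xss) = q^ (sum xs) ⊕ ∑q^sum xss

∑q^sum-count : ∀ xss n → ∑q^sum xss n ≡ + length (filter (λ xs → sum xs ℕ.≟ n) xss)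
∑q^sum-count []         n = refl
-- The test is the one inside `q^`; `filter` compares in the opposite order, whence the uses of
-- `sym`.
∑q^sum-count (xs ∷ xss) n with n ℕ.≟ sum xs
... | yes n≡ = trans (add-congˡ 1ℤ (∑q^sum-count xss n))
                 (cong (λ L → + length L) (sym (filter-accept (λ ys → sum ys ℕ.≟ n) {x = xs} (sym n≡))))
... | no n≢  = trans (ℤ.+-identityˡ _) (trans (∑q^sum-count xss n)
                 (cong (λ L → + length L) (sym (filter-reject (λ ys → sum ys ℕ.≟ n) {x = xs} (λ Σ≡n → n≢ (sym Σ≡n))))))

∑q^sum-++ : ∀ xss yss → ∑q^sum (xss ++ yss) ≗ ∑q^sum xss ⊕ ∑q^sum yss
∑q^sum-++ []         yss n = sym (ℤ.+-identityˡ _)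
∑q^sum-++ (xs ∷ xss) yss n =
  trans (add-congˡ (q^ (sum xs) n) (∑q^sum-++ xss yss n)) (sym (ℤ.+-assoc (q^ (sum xs) n) _ _))

∑q^sum-map-∷ : ∀ x xss → ∑q^sum (map (x ∷_) xss) ≗ q^ x · ∑q^sum xss
∑q^sum-map-∷ x []         n = sym (coeff (zeroʳ (q^ x)) ℕ.≤-refl)
  where open CommutativeRing (truncated n) using (zeroʳ)
∑q^sum-map-∷ x (xs ∷ xss) n = trans
  (cong₂ ℤ._+_ (sym (q^-·-q^ x (sum xs) n)) (∑q^sum-map-∷ x xss n))
  (sym (coeff (distribˡ (q^ x) (q^ (sum xs)) (∑q^sum xss)) ℕ.≤-refl))
  where open CommutativeRing (truncated n) using (distribˡ)

-- Bounding the number of parts by `l` loses only partitions of numbers above `l`, so up to degree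
-- `l` the box has the generating function of all partitions into parts at most `m`. The induction
-- follows the recursion of `box` and closes with (1 - q^{m+1}) + q^{m+1} = 1.
box-series : ∀ m l → f-partial 1 m · ∑q^sum (box m l) ≈[ l ] q^ 0
box-series zero l = ≗⇒≈ λ n → trans (1-· (q^ 0 ⊕ 0ₛ) n) (ℤ.+-identityʳ (q^ 0 n))
box-series (suc m) zero = begin
  f-partial 1 (suc m) · (q^ 0 ⊕ 0ₛ) ≈⟨ *-congˡ {f-partial 1 (suc m)} (+-identityʳ (q^ 0)) ⟩
  f-partial 1 (suc m) · q^ 0        ≈⟨ *-identityʳ _ ⟩
  -- In degree 0 every partial product agrees with `f 1`, hence with the empty product.
  f-partial 1 (suc m)               ≈⟨ f≈ 1 {N = suc m} z≤n ⟨
  f 1                               ≈⟨ f≈ 1 {N = 0} z≤n ⟩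
  q^ 0                              ∎
  where
  open CommutativeRing (truncated 0)
    using (setoid; *-congˡ; *-identityʳ; +-identityʳ)
  open import Relation.Binary.Reasoning.Setoid setoid
box-series (suc m) (suc l) = begin
  F · D · ∑q^sum (box (suc m) (suc l))
    ≈⟨ *-congˡ {F · D} (≗⇒≈ λ n → trans (∑q^sum-++ (box m (suc l)) (map (suc m ∷_) (box (suc m) l)) n)
         (add-congˡ (G n) (∑q^sum-map-∷ (suc m) (box (suc m) l) n))) ⟩
  F · D · (G ⊕ x · H)
    ≈⟨ *-distrib-recurrence F D G x H ⟩
  D · (F · G) ⊕ x · (F · D · H)
    -- The second hypothesis is known only up to degree `l`; the factor `x` supplies the missing
    -- degree.
    ≈⟨ +-cong (*-congˡ {D} (box-series m (suc l))) (q^-·-lift m (box-series (suc m) l)) ⟩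
  D · q^ 0 ⊕ x · q^ 0
    ≈⟨ +-cong (*-identityʳ D) (*-identityʳ x) ⟩
  D ⊕ x
    ≈⟨ ≗⇒≈ (λ n → trans (cong (λ k → 1-q^ k n ℤ.+ x n) (ℕ.*-identityˡ (suc m)))
         (cancel (q^ 0 n) (x n))) ⟩
  q^ 0 ∎
  where
  open CommutativeRing (truncated (suc l))
    using (setoid; *-congˡ; *-identityʳ; +-cong)
  open RingIdentities (truncated (suc l)) using (*-distrib-recurrence)
  open import Relation.Binary.Reasoning.Setoid setoid
  F = f-partial 1 m
  D = 1-q^ (1 * suc m)
  G = ∑q^sum (box m (suc l))
  H = ∑q^sum (box (suc m) l)
  x = q^ (suc m)
  cancel : ∀ u v → u ℤ.- v ℤ.+ v ≡ u
  cancel = ℤ.solve-∀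

1/f₁ : Series
1/f₁ = divide (q^ 0) (f 1) refl

-- `1/f₁` and the generating function of `box n n` are both inverse to `f 1` up to degree `n`, so
-- they agree there.
1/f₁-p : ∀ n → 1/f₁ n ≡ + p n
1/f₁-p n = trans (coeff 1/f₁≈G ℕ.≤-refl) (∑q^sum-count (box n n) n)
  where
  open CommutativeRing (truncated n)
    using (setoid; *-congˡ; *-congʳ; *-identityˡ; *-identityʳ; *-assoc)
  open import Relation.Binary.Reasoning.Setoid setoid
  G = ∑q^sum (box n n)
  1/f₁≈G : 1/f₁ ≈[ n ] G
  1/f₁≈G = begin
    1/f₁                            ≈⟨ *-identityʳ 1/f₁ ⟨
    1/f₁ · q^ 0                     ≈⟨ *-congˡ {1/f₁} (box-series n n) ⟨
    1/f₁ · (f-partial 1 n · G)      ≈⟨ *-congˡ {1/f₁} (*-congʳ {G} (f≈ 1 ℕ.≤-refl)) ⟨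
    1/f₁ · (f 1 · G)                ≈⟨ *-assoc 1/f₁ (f 1) G ⟨
    1/f₁ · f 1 · G                  ≈⟨ *-congʳ {G} (≗⇒≈ (divide-correct (q^ 0) (f 1) refl)) ⟩
    q^ 0 · G                        ≈⟨ *-identityˡ G ⟩
    G                               ∎

-- Gauss's identity for power series and the coefficient of q^n.

∑-last : ∀ K (g : ℕ → ℕ) → ∑[ k ≤ suc K ] g (toℕ k) ≡ ∑[ k ≤ K ] g (toℕ k) + g (suc K)
∑-last K g = trans (sum-init-last {suc K} (λ k → g (toℕ k)))
  (cong₂ _+_ (sum-cong-≗ {suc K} (λ k → cong g (toℕ-inject₁ k))) (cong g (toℕ-fromℕ (suc K))))

module _ (n : ℕ) where
  open CommutativeRing (truncated n) renaming (refl to ≈-refl; sym to ≈-sym; trans to ≈-trans)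
    hiding (_+_; _*_; zero)
  open FiniteGauss (truncated n) (q^ 1)
  open import Algebra.Properties.Semiring.Exp semiring using (_^_)
  open RingIdentities (truncated n) using (divide-by-square)
  open import Relation.Binary.Reasoning.Setoid setoid

  q^≈ : ∀ m → q^ 1 ^ m ≈ q^ m
  q^≈ zero    = ≈-refl
  q^≈ (suc m) = ≈-trans (*-congˡ {q^ 1} (q^≈ m)) (≗⇒≈ (q^-·-q^ 1 m))

  1-q^≈ : ∀ m → 1-q^ m ≈ 1- (q^ 1 ^ m)
  1-q^≈ m = ≈-sym (1-‿cong (q^≈ m))

  f₂≈evens : ∀ N → f-partial 2 N ≈ evens 0 N
  f₂≈evens zero    = ≈-refl
  f₂≈evens (suc N) =
    ≈-trans (*-cong (f₂≈evens N) (1-q^≈ (2 * suc N))) (≈-sym (evens-last 0 N))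

  f₁≈factors : ∀ N → f-partial 1 N ≈ factors N
  f₁≈factors zero    = ≈-refl
  f₁≈factors (suc N) = *-cong (f₁≈factors N)
    (≈-trans (reflexive (cong 1-q^ (ℕ.*-identityˡ (suc N)))) (1-q^≈ (suc N)))

  -- `gauss` applies with the truncation degree as its `n`, since 2n + 1 > n. Up to degree `n`, the
  -- first `n` factors determine `f 2` and the first 2n determine `f 1`.
  f₂²≈f₁·triangular : f 2 · f 2 ≈ f 1 · triangular (2 * n)
  f₂²≈f₁·triangular = begin
    f 2 · f 2                              ≈⟨ *-cong f₂≈ f₂≈ ⟩
    evens 0 n · evens 0 n                  ≈⟨ gauss n q^[1+2n]≈0 ⟩
    factors (2 * n) · triangular (2 * n)   ≈⟨ *-congʳ (≈-trans (f≈ 1 n≤2n) (f₁≈factors (2 * n))) ⟨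
    f 1 · triangular (2 * n)               ∎
    where
    n≤2n : n ≤ 2 * n
    n≤2n = ℕ.m≤n*m n 2
    f₂≈ : f 2 ≈ evens 0 n
    f₂≈ = ≈-trans (f≈ 2 ℕ.≤-refl) (f₂≈evens n)
    q^[1+2n]≈0 : q^ 1 ^ suc (2 * n) ≈ 0ₛ
    q^[1+2n]≈0 = ≈-trans (q^≈ (suc (2 * n)))
      (agree λ i≤n → q^-< (suc (2 * n)) (s≤s (ℕ.≤-trans i≤n n≤2n)))

  EOᵤ-half≈ : EOᵤ-half ≈ triangular (2 * n) · 1/f₁
  EOᵤ-half≈ = divide-by-square {EOᵤ-half} {f 1} {1/f₁} {triangular (2 * n)} (≗⇒≈ (divide-correct (q^ 0) (f 1) refl))
    (≈-trans (≗⇒≈ (divide-correct (f 2 · f 2) (f 1 · f 1) refl)) f₂²≈f₁·triangular)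

  triangular-suc : ∀ K → (triangular (suc K) · 1/f₁) n ≡
                   (triangular K · 1/f₁) n ℤ.+ (q^ (triangle (suc K)) · 1/f₁) n
  triangular-suc K = trans (coeff (distribʳ 1/f₁ (triangular K) (q^ 1 ^ triangle (suc K))) ℕ.≤-refl)
    (add-congˡ ((triangular K · 1/f₁) n) (coeff (*-congʳ {1/f₁} (q^≈ (triangle (suc K)))) ℕ.≤-refl))

  -- Each monomial shifts the index of `1/f₁`; the hypothesis ensures that no subtraction truncates,
  -- where `p 0` would be counted wrongly.
  triangular-sum : ∀ K → (∀ {k} → k ≤ K → triangle k ≤ n) →
    (triangular K · 1/f₁) n ≡ + (∑[ k ≤ K ] p (n ∸ triangle (toℕ k)))
  triangular-sum zero    T≤n = trans (1-· 1/f₁ n)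
    (trans (1/f₁-p n) (cong +_ (sym (ℕ.+-identityʳ (p n)))))
  triangular-sum (suc K) T≤n = trans (triangular-suc K) (trans
    (cong₂ ℤ._+_ (triangular-sum K (λ k≤K → T≤n (ℕ.m≤n⇒m≤1+n k≤K)))
      (trans (q^-·-≥ (triangle (suc K)) 1/f₁ (T≤n ℕ.≤-refl)) (1/f₁-p (n ∸ triangle (suc K)))))
    (cong +_ (sym (∑-last K (λ k → p (n ∸ triangle k))))))

  -- Monomials of degree above `n` do not reach the coefficient of q^n. This bridges the 2n of
  -- Gauss's identity and the smaller bound of the theorem.
  triangular-stable : ∀ d {K} → (∀ {k} → K < k → n < triangle k) →
    (triangular (d + K) · 1/f₁) n ≡ (triangular K · 1/f₁) n
  triangular-stable zero        n<T = refl
  triangular-stable (suc d) {K} n<T = trans (triangular-suc (d + K)) (trans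
    (cong₂ ℤ._+_ (triangular-stable d n<T)
      (q^-·-< (triangle (suc (d + K))) 1/f₁ (n<T (s≤s (ℕ.m≤n+m K d)))))
    (ℤ.+-identityʳ _))

-- The bound of summation.

triangle-*2 : ∀ k → triangle k * 2 ≡ k * (k + 1)
triangle-*2 k = m/n*n≡m (2∣ k)
  where
  step : ∀ k → k * (k + 1) + suc k * 2 ≡ suc k * (suc k + 1)
  step = ℕ.solve-∀
  2∣ : ∀ k → 2 ∣ k * (k + 1)
  2∣ zero    = divides-refl 0
  2∣ (suc k) = ≡.subst (2 ∣_) (step k) (∣m∣n⇒∣m+n (2∣ k) (divides-refl (suc k)))

-- Provides the crude estimate that the bound of summation is at most 2n.
k≤triangle : ∀ k → k ≤ triangle k
k≤triangle zero    = z≤n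
k≤triangle (suc k) = ℕ.*-cancelʳ-≤ (suc k) (triangle (suc k)) 2 (begin
  suc k * 2             ≤⟨ ℕ.*-monoʳ-≤ (suc k) (s≤s (ℕ.m≤n+m 1 k)) ⟩
  suc k * (suc k + 1)   ≡⟨ triangle-*2 (suc k) ⟨
  triangle (suc k) * 2  ∎)
  where open ℕ.≤-Reasoning

1+8*triangle : ∀ k → suc (k * 2) * suc (k * 2) ≡ 1 + 8 * triangle k
1+8*triangle k = begin
  suc (k * 2) * suc (k * 2)    ≡⟨ square k ⟩
  1 + 4 * (k * (k + 1))        ≡⟨ cong (λ m → 1 + 4 * m) (triangle-*2 k) ⟨
  1 + 4 * (triangle k * 2)     ≡⟨ regroup (triangle k) ⟩
  1 + 8 * triangle k           ∎
  where
  open ≡-Reasoning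
  square : ∀ k → suc (k * 2) * suc (k * 2) ≡ 1 + 4 * (k * (k + 1))
  square = ℕ.solve-∀
  regroup : ∀ t → 1 + 4 * (t * 2) ≡ 1 + 8 * t
  regroup = ℕ.solve-∀

-- `≤-floor` gives (2k+1)² ≤ 1 + 8n; completing the square by `1+8*triangle` makes the left side 1 +
-- 8 · `triangle k`, and 1 and 8 cancel.
≤-bound⇔triangle≤ : ∀ n k → k ≤ (⌊√ 1 + 8 * n ⌋ ∸ 1) / 2 ⇔ triangle k ≤ n
≤-bound⇔triangle≤ n k = mk⇔
  (λ k≤ → ℕ.*-cancelˡ-≤ 8 (s≤s⁻¹ (≡.subst (_≤ 1 + 8 * n) (1+8*triangle k) (to k≤))))
  (λ T≤n → from (≡.subst (_≤ 1 + 8 * n) (sym (1+8*triangle k)) (s≤s (ℕ.*-monoʳ-≤ 8 T≤n))))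
  where open Equivalence (≤-floor (1 + 8 * n) k (s≤s z≤n))

theorem3p5 : (n : ℕ) →
    EOᵤ (2 * n) ≡ + (∑[ k ≤ (⌊√ 1 + 8 * n ⌋ ∸ 1) / 2 ] p (n ∸ toℕ k * (toℕ k + 1) / 2))
theorem3p5 n = begin
  EOᵤ (2 * n)                                 ≡⟨ EOᵤ≗dilate (2 * n) ⟨
  dilate EOᵤ-half (2 * n)                     ≡⟨ dilate-even EOᵤ-half n ⟩
  EOᵤ-half n                                  ≡⟨ coeff (EOᵤ-half≈ n) ℕ.≤-refl ⟩
  -- Writing 2n as (2n - K) + K exposes the terms beyond `K`, whose exponents exceed `n` by the
  -- maximality of `K`.
  (triangular (2 * n) · 1/f₁) n               ≡⟨ cong (λ M → (triangular M · 1/f₁) n) (ℕ.m∸n+n≡m K≤2n) ⟨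
  (triangular (2 * n ∸ K + K) · 1/f₁) n       ≡⟨ triangular-stable n (2 * n ∸ K) (λ {k} K<k →
                                                   ℕ.≰⇒> λ T≤n → ℕ.<⇒≱ K<k (from (≤-bound⇔triangle≤ n k) T≤n)) ⟩
  (triangular K · 1/f₁) n                     ≡⟨ triangular-sum n K (λ {k} → to (≤-bound⇔triangle≤ n k)) ⟩
  + (∑[ k ≤ K ] p (n ∸ triangle (toℕ k)))     ∎
  where
  open ≡-Reasoning
  open Equivalence using (to; from)
  open FiniteGauss (truncated n) (q^ 1) using (triangular)
  K = (⌊√ 1 + 8 * n ⌋ ∸ 1) / 2
  K≤2n : K ≤ 2 * n
  K≤2n = ℕ.≤-trans (k≤triangle K)
    (ℕ.≤-trans (to (≤-bound⇔triangle≤ n K) ℕ.≤-refl) (ℕ.m≤n*m n 2))
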